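{- Let $n,k\in\mathbb{N}$ with $n\equiv k\pmod 2$. Then there is a bijection between $\mathcal{C}_{\frac{n-k}{2},\frac{n+k}{2}}$ and $\mathcal{Z}_{n,k}^+$, and a bijection between $\mathcal{C}_{\frac{n-k}{2},\frac{n+k}{2}}$ and $\mathcal{Z}_{n,k}^-$.
   Context: A grand zigzag knight's path is a lattice path in $\mathbb{Z}^2$ starting at the origin, made of steps $N=(1,2)$, $\bar N=(1,-2)$, $E=(2,1)$, $\bar E=(2,-1)$, such that the vertical components of two consecutive steps never have the same direction (up-steps $N,E$ and down-steps $\bar N,\bar E$ alternate). The size is the $x$-coordinate and the altitude the $y$-coordinate of the last point. $\mathcal{Z}_{n,k}^+$ (resp. $\mathcal{Z}_{n,k}^-$) is the set of grand zigzag knight's paths of size $n$ and altitude $k$ starting with $E$ or $N$ (resp. with $\bar E$ or $\bar N$), with the convention that the empty path belongs to both $\mathcal{Z}_{0,0}^+$ and $\mathcal{Z}_{0,0}^-$. For integers $a,b$, $\mathcal{C}_{a,b}$ is the set of ordered pairs $(X,Y)$ where $X$ is a composition of $a$ and $Y$ a composition of $b$ with every part equal to $1$ or $2$ and such that $X$ and $Y$ have the same number of parts; the empty sequence is the unique composition of $0$, and $\mathcal{C}_{a,b}=\varnothing$ if $a<0$ or $b<0$. Here $\mathbb{N}$ includes $0$. -}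

module Defs where

open import Data.Integer.Base using (ℤ; +_; -[1+_]; _+_; sign)
open import Data.List.Base using (List; foldr; head; length; sum)
open import Data.List.Relation.Unary.All as All using (All)
open import Data.List.Relation.Unary.Linked as Linked using (Linked)
import Data.Maybe.Relation.Unary.All as Maybe
open import Data.Nat.Base using (ℕ; _<_)
import Data.Nat.Properties as ℕ
open import Data.Product.Base using (Σ-syntax; _×_; _,_; proj₂)
open import Data.Sign.Base using (Sign)
open import Data.Sum.Base using (_⊎_; inj₁; inj₂)
open import Relation.Binary.PropositionalEquality using (_≡_; _≢_; refl; cong; cong₂)
open import Relation.Nullary.Irrelevant using (Irrelevant)

-- N↓ and E↓ stand for N and E with a bar.
data Step : Set where
  N N↓ E E↓ : Step

vector : Step → ℤ × ℤ
vector N  = + 1 , + 2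
vector N↓ = + 1 , -[1+ 1 ]
vector E  = + 2 , + 1
vector E↓ = + 2 , -[1+ 0 ]

infixl 6 _⊕_

_⊕_ : ℤ × ℤ → ℤ × ℤ → ℤ × ℤ
(x , y) ⊕ (x′ , y′) = x + x′ , y + y′

-- A path from the origin is given by its sequence of steps.
Path : Set
Path = List Step

lastPoint : Path → ℤ × ℤ
lastPoint = foldr (λ s p → vector s ⊕ p) (+ 0 , + 0)

-- No step is horizontal, so the sign of the vertical component is its direction.
direction : Step → Sign
direction s = sign (proj₂ (vector s))

IsGrandZigzag : Path → Set
IsGrandZigzag = Linked (λ s t → direction s ≢ direction t)

-- Both of these hold of the empty path, which has no first step.
Starts⁺ Starts⁻ : Path → Set
Starts⁺ p = Maybe.All (λ s → s ≡ E  ⊎ s ≡ N)  (head p)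
Starts⁻ p = Maybe.All (λ s → s ≡ E↓ ⊎ s ≡ N↓) (head p)

Z⁺ Z⁻ : ℕ → ℤ → Set
Z⁺ n k = Σ[ p ∈ Path ] IsGrandZigzag p × lastPoint p ≡ (+ n , k) × Starts⁺ p
Z⁻ n k = Σ[ p ∈ Path ] IsGrandZigzag p × lastPoint p ≡ (+ n , k) × Starts⁻ p

-- The index is an integer, so that a negative number has no compositions.
IsComposition : ℤ → List ℕ → Set
IsComposition a X = All (0 <_) X × + sum X ≡ a

PartsIn12 : List ℕ → Set
PartsIn12 = All (λ x → x ≡ 1 ⊎ x ≡ 2)

IsPair : ℤ → ℤ → List ℕ × List ℕ → Set
IsPair a b (X , Y) =
  (IsComposition a X × PartsIn12 X) ×
  (IsComposition b Y × PartsIn12 Y) ×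
  length X ≡ length Y

C : ℤ → ℤ → Set
C a b = Σ[ XY ∈ List ℕ × List ℕ ] IsPair a b XY

-- The defining conditions of Z⁺, Z⁻ and C are propositions, so elements of
-- these types are equal as soon as the underlying paths, or pairs of
-- sequences, are; a bijection of types is thus a bijection of sets.

private
  ×-irr : ∀ {A B : Set} → Irrelevant A → Irrelevant B → Irrelevant (A × B)
  ×-irr f g (a , b) (a′ , b′) = cong₂ _,_ (f a a′) (g b b′)

  ≡-irr : ∀ {A : Set} {x y : A} → Irrelevant (x ≡ y)
  ≡-irr refl refl = refl

  ⊎≡-irr : ∀ {A : Set} {u v : A} → u ≢ v → ∀ {x} → Irrelevant (x ≡ u ⊎ x ≡ v)
  ⊎≡-irr _   (inj₁ p)    (inj₁ q)    = cong inj₁ (≡-irr p q)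
  ⊎≡-irr _   (inj₂ p)    (inj₂ q)    = cong inj₂ (≡-irr p q)
  ⊎≡-irr u≢v (inj₁ refl) (inj₂ refl) with () ← u≢v refl
  ⊎≡-irr u≢v (inj₂ refl) (inj₁ refl) with () ← u≢v refl

IsGrandZigzag-irrelevant : ∀ {p} → Irrelevant (IsGrandZigzag p)
IsGrandZigzag-irrelevant = Linked.irrelevant (λ _ _ → refl)

Starts⁺-irrelevant : ∀ {p} → Irrelevant (Starts⁺ p)
Starts⁺-irrelevant = Maybe.irrelevant (⊎≡-irr λ ())

Starts⁻-irrelevant : ∀ {p} → Irrelevant (Starts⁻ p)
Starts⁻-irrelevant = Maybe.irrelevant (⊎≡-irr λ ())

Z⁺-condition-irrelevant : ∀ {n k p} →
  Irrelevant (IsGrandZigzag p × lastPoint p ≡ (+ n , k) × Starts⁺ p)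
Z⁺-condition-irrelevant =
  ×-irr IsGrandZigzag-irrelevant (×-irr ≡-irr Starts⁺-irrelevant)

Z⁻-condition-irrelevant : ∀ {n k p} →
  Irrelevant (IsGrandZigzag p × lastPoint p ≡ (+ n , k) × Starts⁻ p)
Z⁻-condition-irrelevant =
  ×-irr IsGrandZigzag-irrelevant (×-irr ≡-irr Starts⁻-irrelevant)

IsPair-irrelevant : ∀ {a b XY} → Irrelevant (IsPair a b XY)
IsPair-irrelevant = ×-irr composition (×-irr composition ≡-irr)
  where
  composition : ∀ {a X} → Irrelevant (IsComposition a X × PartsIn12 X)
  composition =
    ×-irr (×-irr (All.irrelevant ℕ.≤-irrelevant) ≡-irr)
          (All.irrelevant (⊎≡-irr λ ()))

{-# OPTIONS --safe #-}

-- A step changes x + y by an odd amount, so a path ending at (n , k) with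
-- n ≡ k (mod 2) has an even number of steps and splits into blocks of one
-- up-step and one down-step. Record in X a 1 for each N and a 2 for each E, and
-- in Y a 1 for each N↓ and a 2 for each E↓. The block with entries x and y
-- displaces by (x + y , y - x), in whichever order its two steps are taken, so
-- the path ends at (n , k) exactly when X sums to (n - k) / 2 and Y to
-- (n + k) / 2.
module Submission where

open import Defs
open import Data.Integer.Base using (ℤ; +_; -_; _+_; _-_; _*_; ∣_∣; NonZero)
open import Data.Integer.DivMod using (_/_; _/ℕ_; a≡a%n+[a/n]*n; a≡a%ℕn+[a/ℕn]*n; n%d<d)
import Data.Integer.DivMod as ℤ using (_%_)
open import Data.Integer.Divisibility.Signed
  using (_∣_; divides; _∣?_; ∣-refl; ∣⇒∣ᵤ; ∣m+n∣m⇒∣n; ∣m+n∣n⇒∣m; ∣m∣n⇒∣m+n; ∣n⇒∣m*n)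
open import Data.Integer.Properties
  using (+-identityˡ; +-assoc; pos-+; *-cancelʳ-≡; *-distribʳ-+)
open import Data.Integer.Tactic.RingSolver using (solve-∀)
open import Data.List.Base using (List; []; _∷_; head; length)
open import Data.List.Properties using (∷-injective)
open import Data.List.Relation.Unary.All as All using ([]; _∷_)
open import Data.List.Relation.Unary.Linked using ([]; [-]; _∷_; tail)
import Data.Maybe.Relation.Unary.All as Maybe
open import Data.Nat.Base as ℕ using (ℕ; suc; _<_; z<s; _%_)
open import Data.Nat.Divisibility using (n∣m⇒m%n≡0)
open import Data.Nat.DivMod using (m<n⇒m%n≡m)
open import Data.Nat.ListAction using (sum)
open import Data.Product.Base using (Σ; ∃₂; _×_; _,_; proj₁; proj₂)
open import Data.Sign.Base using (Sign; opposite)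
open import Data.Sign.Properties using (s≢opposite[s]; opposite-involutive)
open import Data.Sum.Base using (_⊎_; inj₁; inj₂)
open import Function.Bundles using (_⤖_; mk⤖)
open import Function.Consequences.Propositional using (strictlySurjective⇒surjective)
open import Relation.Binary.PropositionalEquality
  using (_≡_; _≢_; refl; sym; trans; cong; cong₂; subst; module ≡-Reasoning)
open import Relation.Binary.PropositionalEquality.WithK using (≡-irrelevant)
open import Relation.Nullary.Decidable using (from-no)
open import Relation.Nullary.Irrelevant using (Irrelevant)
open import Relation.Nullary.Negation using (¬_; contradiction)

open ≡-Reasoning

-- Integer division and parity

∣⇒[m/d]*d≡m : ∀ m d .{{_ : NonZero d}} → d ∣ m → (m / d) * d ≡ m
∣⇒[m/d]*d≡m m d d∣m = sym (begin
  m                           ≡⟨ a≡a%n+[a/n]*n m d ⟩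
  + (m ℤ.% d) + (m / d) * d   ≡⟨ cong (λ r → + r + (m / d) * d) remainder≡0 ⟩
  + 0 + (m / d) * d           ≡⟨ +-identityˡ _ ⟩
  (m / d) * d                 ∎)
  where
  d∣remainder : d ∣ + (m ℤ.% d)
  d∣remainder = ∣m+n∣n⇒∣m (subst (d ∣_) (a≡a%n+[a/n]*n m d) d∣m)
                          (∣n⇒∣m*n (m / d) ∣-refl)

  -- The remainder is a multiple of `d` and smaller than `∣ d ∣`, so it vanishes.
  remainder≡0 : m ℤ.% d ≡ 0
  remainder≡0 = trans (sym (m<n⇒m%n≡m (n%d<d m d)))
                      (n∣m⇒m%n≡0 _ ∣ d ∣ (∣⇒∣ᵤ d∣remainder))

-- The common remainder cancels, leaving the difference of the quotients as witness.
%≡%⇒∣m-n : ∀ m n d .{{_ : ℕ.NonZero d}} → m % d ≡ n % d → + d ∣ + m - + n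
%≡%⇒∣m-n m n d m%d≡n%d = divides (qₘ - qₙ) (begin
  + m - + n
    ≡⟨ cong₂ _-_ (a≡a%ℕn+[a/ℕn]*n (+ m) d) (a≡a%ℕn+[a/ℕn]*n (+ n) d) ⟩
  (+ (m % d) + qₘ * + d) - (+ (n % d) + qₙ * + d)
    ≡⟨ cong (λ r → (+ r + qₘ * + d) - (+ (n % d) + qₙ * + d)) m%d≡n%d ⟩
  (+ (n % d) + qₘ * + d) - (+ (n % d) + qₙ * + d)
    ≡⟨ cancel (+ (n % d)) qₘ qₙ (+ d) ⟩
  (qₘ - qₙ) * + d ∎)
  where
  qₘ = + m /ℕ d
  qₙ = + n /ℕ d

  cancel : ∀ r q q′ d → (r + q * d) - (r + q′ * d) ≡ (q - q′) * d
  cancel = solve-∀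

-- From pairs of sequences to zigzag paths

StartsWith : Sign → Path → Set
StartsWith s p = Maybe.All (λ t → direction t ≡ s) (head p)

-- The catch-all clauses are meant for the entry 2; sending 0 and the numbers above 2 there too
-- merely keeps the functions total.
up down : ℕ → Step
up 1 = N
up _ = E
down 1 = N↓
down _ = E↓

-- Selecting by sign lets one construction serve both kinds of path: a block is the step of
-- direction `s` followed by that of direction `opposite s`.
blockStep : ℕ → ℕ → Sign → Step
blockStep x y Sign.+ = up x
blockStep x y Sign.- = down y

zigzag : Sign → List ℕ → List ℕ → Path
zigzag s (x ∷ X) (y ∷ Y) =
  blockStep x y s ∷ blockStep x y (opposite s) ∷ zigzag s X Y
-- With equal lengths this is reached only when both sequences are empty; otherwise the surplus of
-- the longer one is dropped.
zigzag s _ _ = []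

direction-up : ∀ x → direction (up x) ≡ Sign.+
direction-up 0 = refl
direction-up 1 = refl
direction-up (suc (suc _)) = refl

direction-down : ∀ y → direction (down y) ≡ Sign.-
direction-down 0 = refl
direction-down 1 = refl
direction-down (suc (suc _)) = refl

direction-blockStep : ∀ x y s → direction (blockStep x y s) ≡ s
direction-blockStep x y Sign.+ = direction-up x
direction-blockStep x y Sign.- = direction-down y

zigzag-starts : ∀ s X Y → StartsWith s (zigzag s X Y)
zigzag-starts s [] Y = Maybe.nothing
zigzag-starts s (_ ∷ _) [] = Maybe.nothing
zigzag-starts s (x ∷ X) (y ∷ Y) = Maybe.just (direction-blockStep x y s)

-- Only the new junction has to be checked, and `StartsWith` supplies the direction of the step
-- after it.
∷-isGrandZigzag : ∀ {s t p} → direction t ≢ s → StartsWith s p →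
                  IsGrandZigzag p → IsGrandZigzag (t ∷ p)
∷-isGrandZigzag {p = []}    _   _                 _  = [-]
∷-isGrandZigzag {p = _ ∷ _} t≢s (Maybe.just refl) zz = t≢s ∷ zz

zigzag-isGrandZigzag : ∀ s X Y → IsGrandZigzag (zigzag s X Y)
zigzag-isGrandZigzag s [] Y = []
zigzag-isGrandZigzag s (_ ∷ _) [] = []
zigzag-isGrandZigzag s (x ∷ X) (y ∷ Y) =
  ∷-isGrandZigzag
    (λ eq → s≢opposite[s] s (trans (sym (direction-blockStep x y s)) eq))
    (Maybe.just (direction-blockStep x y (opposite s)))
    (∷-isGrandZigzag
      (λ eq → s≢opposite[s] s (trans (sym eq) (direction-blockStep x y (opposite s))))
      (zigzag-starts s X Y)
      (zigzag-isGrandZigzag s X Y))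

-- Injectivity

Is12 : ℕ → Set
Is12 x = x ≡ 1 ⊎ x ≡ 2

up-injective : ∀ {x x′} → Is12 x → Is12 x′ → up x ≡ up x′ → x ≡ x′
up-injective (inj₁ refl) (inj₁ refl) _ = refl
up-injective (inj₁ refl) (inj₂ refl) ()
up-injective (inj₂ refl) (inj₁ refl) ()
up-injective (inj₂ refl) (inj₂ refl) _ = refl

down-injective : ∀ {y y′} → Is12 y → Is12 y′ → down y ≡ down y′ → y ≡ y′
down-injective (inj₁ refl) (inj₁ refl) _ = refl
down-injective (inj₁ refl) (inj₂ refl) ()
down-injective (inj₂ refl) (inj₁ refl) ()
down-injective (inj₂ refl) (inj₂ refl) _ = refl

-- The up-step of a block determines `x` and the down-step `y`; the sign tells which equation
-- concerns which.
blockSteps-injective : ∀ s {x y x′ y′} → Is12 x → Is12 y → Is12 x′ → Is12 y′ →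
  blockStep x y s ≡ blockStep x′ y′ s →
  blockStep x y (opposite s) ≡ blockStep x′ y′ (opposite s) →
  x ≡ x′ × y ≡ y′
blockSteps-injective Sign.+ px py px′ py′ e f =
  up-injective px px′ e , down-injective py py′ f
blockSteps-injective Sign.- px py px′ py′ e f =
  up-injective px px′ f , down-injective py py′ e

-- Equal lengths ensure that no entry is lost to truncation, so blocks can be compared one by one.
zigzag-injective : ∀ s {X Y X′ Y′} →
  PartsIn12 X → PartsIn12 Y → length X ≡ length Y →
  PartsIn12 X′ → PartsIn12 Y′ → length X′ ≡ length Y′ →
  zigzag s X Y ≡ zigzag s X′ Y′ → (X , Y) ≡ (X′ , Y′)
zigzag-injective s [] [] _ [] [] _ _ = refl
zigzag-injective s [] [] _ (_ ∷ _) (_ ∷ _) _ ()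
zigzag-injective s (_ ∷ _) (_ ∷ _) _ [] [] _ ()
zigzag-injective s (px ∷ pX) (py ∷ pY) l (px′ ∷ pX′) (py′ ∷ pY′) l′ eq
  with e , eq′ ← ∷-injective eq
  with f , eq″ ← ∷-injective eq′
  with refl , refl ← blockSteps-injective s px py px′ py′ e f
  with refl ← zigzag-injective s pX pY (cong ℕ.pred l) pX′ pY′ (cong ℕ.pred l′) eq″
  = refl

-- The endpoint of a zigzag path

blockVector : ℕ → ℕ → ℤ × ℤ
blockVector x y = + x + + y , + y - + x

-- On entries 1 and 2, `up x` has vector (x, 3 - x) and `down y` has vector (y, y - 3), so the
-- threes cancel.
blockVector-blockSteps : ∀ s {x y} → Is12 x → Is12 y →
  vector (blockStep x y s) ⊕ vector (blockStep x y (opposite s)) ≡ blockVector x y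
blockVector-blockSteps Sign.+ (inj₁ refl) (inj₁ refl) = refl
blockVector-blockSteps Sign.+ (inj₁ refl) (inj₂ refl) = refl
blockVector-blockSteps Sign.+ (inj₂ refl) (inj₁ refl) = refl
blockVector-blockSteps Sign.+ (inj₂ refl) (inj₂ refl) = refl
blockVector-blockSteps Sign.- (inj₁ refl) (inj₁ refl) = refl
blockVector-blockSteps Sign.- (inj₁ refl) (inj₂ refl) = refl
blockVector-blockSteps Sign.- (inj₂ refl) (inj₁ refl) = refl
blockVector-blockSteps Sign.- (inj₂ refl) (inj₂ refl) = refl

⊕-assoc : ∀ u v w → (u ⊕ v) ⊕ w ≡ u ⊕ (v ⊕ w)
⊕-assoc (a , a′) (b , b′) (c , c′) = cong₂ _,_ (+-assoc a b c) (+-assoc a′ b′ c′)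

lastPoint-block : ∀ s {x y} p → Is12 x → Is12 y →
  lastPoint (blockStep x y s ∷ blockStep x y (opposite s) ∷ p) ≡
  blockVector x y ⊕ lastPoint p
lastPoint-block s {x} {y} p px py =
  trans (sym (⊕-assoc (vector (blockStep x y s)) _ (lastPoint p)))
        (cong (_⊕ lastPoint p) (blockVector-blockSteps s px py))

blockVector-+ : ∀ x y x′ y′ →
  blockVector x y ⊕ blockVector x′ y′ ≡ blockVector (x ℕ.+ x′) (y ℕ.+ y′)
blockVector-+ x y x′ y′
  rewrite pos-+ x x′ | pos-+ y y′ =
  cong₂ _,_ (sums (+ x) (+ y) (+ x′) (+ y′)) (differences (+ x) (+ y) (+ x′) (+ y′))
  where
  sums : ∀ a b c d → (a + b) + (c + d) ≡ (a + c) + (b + d)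
  sums = solve-∀

  differences : ∀ a b c d → (b - a) + (d - c) ≡ (b + d) - (a + c)
  differences = solve-∀

lastPoint-zigzag : ∀ s {X Y} → PartsIn12 X → PartsIn12 Y → length X ≡ length Y →
                   lastPoint (zigzag s X Y) ≡ blockVector (sum X) (sum Y)
lastPoint-zigzag s [] [] _ = refl
lastPoint-zigzag s {x ∷ X} {y ∷ Y} (px ∷ pX) (py ∷ pY) l = begin
  lastPoint (zigzag s (x ∷ X) (y ∷ Y))
    ≡⟨ lastPoint-block s (zigzag s X Y) px py ⟩
  blockVector x y ⊕ lastPoint (zigzag s X Y)
    ≡⟨ cong (blockVector x y ⊕_) (lastPoint-zigzag s pX pY (cong ℕ.pred l)) ⟩
  blockVector x y ⊕ blockVector (sum X) (sum Y)
    ≡⟨ blockVector-+ x y (sum X) (sum Y) ⟩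
  blockVector (x ℕ.+ sum X) (y ℕ.+ sum Y) ∎

-- Parity of the endpoint and surjectivity

EvenSum : ℤ × ℤ → Set
EvenSum (x , y) = + 2 ∣ x + y

-- The coordinate sums are 3, -1, 3 and 1. Adding `(+ 0 , + 0)` makes the point literally
-- `lastPoint (t ∷ [])`.
vector-odd : ∀ t → ¬ EvenSum (vector t ⊕ (+ 0 , + 0))
vector-odd N  = from-no (+ 2 ∣? + 3)
vector-odd N↓ = from-no (+ 2 ∣? - + 1)
vector-odd E  = from-no (+ 2 ∣? + 3)
vector-odd E↓ = from-no (+ 2 ∣? + 1)

-- A block contributes (x + y) + (y - x) = 2y to the coordinate sum, so removing it preserves
-- parity.
evenSum-tail : ∀ x y v → EvenSum (blockVector x y ⊕ v) → EvenSum v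
evenSum-tail x y (a , b) even =
  ∣m+n∣m⇒∣n (subst (+ 2 ∣_) (regroup (+ x) (+ y) a b) even) (∣n⇒∣m*n (+ y) ∣-refl)
  where
  regroup : ∀ x y a b → (x + y + a) + (y - x + b) ≡ y * + 2 + (a + b)
  regroup = solve-∀

≢⇒≡opposite : ∀ {s t : Sign} → s ≢ t → t ≡ opposite s
≢⇒≡opposite {Sign.+} {Sign.+} s≢t = contradiction refl s≢t
≢⇒≡opposite {Sign.+} {Sign.-} s≢t = refl
≢⇒≡opposite {Sign.-} {Sign.+} s≢t = refl
≢⇒≡opposite {Sign.-} {Sign.-} s≢t = contradiction refl s≢t

up-surjective : ∀ t → direction t ≡ Sign.+ → Σ ℕ λ x → Is12 x × up x ≡ t
up-surjective N _ = 1 , inj₁ refl , refl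
up-surjective E _ = 2 , inj₂ refl , refl

down-surjective : ∀ t → direction t ≡ Sign.- → Σ ℕ λ y → Is12 y × down y ≡ t
down-surjective N↓ _ = 1 , inj₁ refl , refl
down-surjective E↓ _ = 2 , inj₂ refl , refl

blockSteps-surjective : ∀ s t u → direction t ≡ s → direction u ≡ opposite s →
  ∃₂ λ x y → Is12 x × Is12 y × blockStep x y s ≡ t × blockStep x y (opposite s) ≡ u
blockSteps-surjective Sign.+ t u t≡ u≡
  with x , px , ex ← up-surjective t t≡
  with y , py , ey ← down-surjective u u≡ = x , y , px , py , ex , ey
blockSteps-surjective Sign.- t u t≡ u≡
  with x , px , ex ← up-surjective u u≡
  with y , py , ey ← down-surjective t t≡ = x , y , px , py , ey , ex

startsWith-tail : ∀ {t p} → IsGrandZigzag (t ∷ p) →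
                  StartsWith (opposite (direction t)) p
startsWith-tail [-]       = Maybe.nothing
startsWith-tail (t≢u ∷ _) = Maybe.just (≢⇒≡opposite t≢u)

-- The induction strips two steps at a time, and parity excludes a single leftover step.
zigzag-surjective : ∀ s p → IsGrandZigzag p → StartsWith s p → EvenSum (lastPoint p) →
  ∃₂ λ X Y → PartsIn12 X × PartsIn12 Y × length X ≡ length Y × zigzag s X Y ≡ p
zigzag-surjective s [] _ _ _ = [] , [] , [] , [] , refl , refl
zigzag-surjective s (t ∷ []) _ _ even = contradiction even (vector-odd t)
zigzag-surjective s (t ∷ u ∷ p) (t≢u ∷ zz) (Maybe.just t≡s) even
  with u≡ ← trans (≢⇒≡opposite t≢u) (cong opposite t≡s)
  with x , y , px , py , refl , refl ← blockSteps-surjective s t u t≡s u≡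
  with X , Y , pX , pY , l , refl ← zigzag-surjective s p (tail zz)
         -- The second step of the block has direction `opposite s`, so alternation makes the rest
         -- begin with direction `s` again.
         (subst (λ s′ → StartsWith s′ p)
                (trans (cong opposite u≡) (opposite-involutive s))
                (startsWith-tail zz))
         (evenSum-tail x y (lastPoint p) (subst EvenSum (lastPoint-block s p px py) even))
  = x ∷ X , y ∷ Y , px ∷ pX , py ∷ pY , cong suc l , refl

-- The bijection for either sign

partsIn12⇒positive : ∀ {X} → PartsIn12 X → All.All (0 <_) X
partsIn12⇒positive = All.map λ { (inj₁ refl) → z<s ; (inj₂ refl) → z<s }

proj₁-injective : ∀ {A : Set} {B : A → Set} → (∀ {x} → Irrelevant (B x)) →
                  {u v : Σ A B} → proj₁ u ≡ proj₁ v → u ≡ v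
proj₁-injective irr {x , b} {.x , c} refl = cong (x ,_) (irr b c)

module _ {a b n k : ℤ} (2a≡n-k : a * + 2 ≡ n - k) (2b≡n+k : b * + 2 ≡ n + k) where

  -- The hypotheses know `a` and `b` only through their doubles, so each coordinate is compared
  -- after doubling.
  ab⇒nk : (a + b , b - a) ≡ (n , k)
  ab⇒nk = cong₂ _,_
    (*-cancelʳ-≡ (a + b) n (+ 2) (begin
      (a + b) * + 2       ≡⟨ *-distribʳ-+ (+ 2) a b ⟩
      a * + 2 + b * + 2   ≡⟨ cong₂ _+_ 2a≡n-k 2b≡n+k ⟩
      n - k + (n + k)     ≡⟨ sums n k ⟩
      n * + 2             ∎))
    (*-cancelʳ-≡ (b - a) k (+ 2) (begin
      (b - a) * + 2       ≡⟨ distrib b a ⟩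
      b * + 2 - a * + 2   ≡⟨ cong₂ _-_ 2b≡n+k 2a≡n-k ⟩
      n + k - (n - k)     ≡⟨ differences n k ⟩
      k * + 2             ∎))
    where
    sums : ∀ n k → n - k + (n + k) ≡ n * + 2
    sums = solve-∀
    distrib : ∀ b a → (b - a) * + 2 ≡ b * + 2 - a * + 2
    distrib = solve-∀
    differences : ∀ n k → n + k - (n - k) ≡ k * + 2
    differences = solve-∀

  nk⇒ab : ∀ {x y} → (x + y , y - x) ≡ (n , k) → x ≡ a × y ≡ b
  nk⇒ab {x} {y} refl =
    *-cancelʳ-≡ x a (+ 2) (trans (lower x y) (sym 2a≡n-k)) ,
    *-cancelʳ-≡ y b (+ 2) (trans (upper x y) (sym 2b≡n+k))
    where
    lower : ∀ x y → x * + 2 ≡ (x + y) - (y - x)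
    lower = solve-∀
    upper : ∀ x y → y * + 2 ≡ (x + y) + (y - x)
    upper = solve-∀

  -- Keeping `Starts` abstract, as any proposition equivalent to `StartsWith s`, covers `Starts⁺`
  -- and `Starts⁻` in one argument.
  C⤖zigzags : ∀ s {Starts : Path → Set} →
    (∀ {p} → Irrelevant (Starts p)) →
    (∀ {p} → Starts p → StartsWith s p) →
    (∀ {p} → StartsWith s p → Starts p) →
    C a b ⤖ Σ Path λ p → IsGrandZigzag p × lastPoint p ≡ (n , k) × Starts p
  C⤖zigzags s {Starts} irr to from = mk⤖ (injective , strictlySurjective⇒surjective surjective)
    where
    Z : Set
    Z = Σ Path λ p → IsGrandZigzag p × lastPoint p ≡ (n , k) × Starts p

    Z-condition-irrelevant : ∀ {p} →
      Irrelevant (IsGrandZigzag p × lastPoint p ≡ (n , k) × Starts p)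
    Z-condition-irrelevant (z , e , t) (z′ , e′ , t′) =
      cong₂ _,_ (IsGrandZigzag-irrelevant z z′) (cong₂ _,_ (≡-irrelevant e e′) (irr t t′))

    f : C a b → Z
    f ((X , Y) , ((_ , ΣX≡a) , pX) , ((_ , ΣY≡b) , pY) , l) =
      zigzag s X Y , zigzag-isGrandZigzag s X Y ,
      trans (lastPoint-zigzag s pX pY l)
            (trans (cong₂ (λ x y → x + y , y - x) ΣX≡a ΣY≡b) ab⇒nk) ,
      from (zigzag-starts s X Y)

    injective : ∀ {u v} → f u ≡ f v → u ≡ v
    injective {_ , (_ , pX) , (_ , pY) , l} {_ , (_ , pX′) , (_ , pY′) , l′} eq =
      proj₁-injective IsPair-irrelevant
        (zigzag-injective s pX pY l pX′ pY′ l′ (cong proj₁ eq))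

    surjective : ∀ z → Σ (C a b) λ u → f u ≡ z
    surjective (p , zz , end , st)
      with X , Y , pX , pY , l , refl ← zigzag-surjective s p zz (to st)
             -- The endpoint has coordinate sum n + k, which is twice `b`.
             (subst EvenSum (sym end) (divides b (sym 2b≡n+k)))
      with ΣX≡a , ΣY≡b ← nk⇒ab (trans (sym (lastPoint-zigzag s pX pY l)) end) =
      ((X , Y) ,
        ((partsIn12⇒positive pX , ΣX≡a) , pX) ,
        ((partsIn12⇒positive pY , ΣY≡b) , pY) , l) ,
      proj₁-injective Z-condition-irrelevant refl

starts⁺⇒ : ∀ {p} → Starts⁺ p → StartsWith Sign.+ p
starts⁺⇒ = Maybe.map λ { (inj₁ refl) → refl ; (inj₂ refl) → refl }

starts⁺⇐ : ∀ {p} → StartsWith Sign.+ p → Starts⁺ p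
starts⁺⇐ = Maybe.map λ { {N} _ → inj₂ refl ; {E} _ → inj₁ refl }

starts⁻⇒ : ∀ {p} → Starts⁻ p → StartsWith Sign.- p
starts⁻⇒ = Maybe.map λ { (inj₁ refl) → refl ; (inj₂ refl) → refl }

starts⁻⇐ : ∀ {p} → StartsWith Sign.- p → Starts⁻ p
starts⁻⇐ = Maybe.map λ { {N↓} _ → inj₂ refl ; {E↓} _ → inj₁ refl }

lemma3p2 : (n k : ℕ) → n % 2 ≡ k % 2 →
    (C ((+ n - + k) / + 2) ((+ n + + k) / + 2) ⤖ Z⁺ n (+ k)) ×
    (C ((+ n - + k) / + 2) ((+ n + + k) / + 2) ⤖ Z⁻ n (+ k))
lemma3p2 n k n≡k =
  C⤖zigzags 2a≡n-k 2b≡n+k Sign.+ Starts⁺-irrelevant starts⁺⇒ starts⁺⇐ ,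
  C⤖zigzags 2a≡n-k 2b≡n+k Sign.- Starts⁻-irrelevant starts⁻⇒ starts⁻⇐
  where
  2∣n-k : + 2 ∣ + n - + k
  2∣n-k = %≡%⇒∣m-n n k 2 n≡k

  2∣n+k : + 2 ∣ + n + + k
  2∣n+k = subst (+ 2 ∣_) (n-k+2k (+ n) (+ k)) (∣m∣n⇒∣m+n 2∣n-k (∣n⇒∣m*n (+ k) ∣-refl))
    where
    n-k+2k : ∀ n k → n - k + k * + 2 ≡ n + k
    n-k+2k = solve-∀

  2a≡n-k = ∣⇒[m/d]*d≡m (+ n - + k) (+ 2) 2∣n-k
  2b≡n+k = ∣⇒[m/d]*d≡m (+ n + + k) (+ 2) 2∣n+k
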